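{- Let $\mathcal C$ be a cartesian $R$-differential category with tangent functor $T$. For all $n,m\in\mathbb N$, the families $\iota^n_X:X\to T^nX$, $\theta^n_X:T^nT^nX\to T^nX$ and $c^{n,m}_X:T^nT^mX\to T^mT^nX$ are natural transformations $\iota^n:\mathrm{Id}\Rightarrow T^n$, $\theta^n:T^nT^n\Rightarrow T^n$, $c^{n,m}:T^nT^m\Rightarrow T^mT^n$ of functors on $\mathcal C$. Consequently $(T^n,\iota^n,\theta^n)$ is a monad on $\mathcal C$, and $c^{n,m}$ is a distributive law of the monad $T^n$ over the monad $T^m$.
   Context: $R$ is a commutative semiring. A map between $R$-semimodules is $R$-additive if it preserves sums, $0$ and the action of $R$. A left $R$-additive category is a category $\mathcal C$ whose hom-sets are $R$-semimodules and such that every precomposition map $\_\circ f$ is $R$-additive; a morphism $h:Y\to Z$ is $R$-additive if every postcomposition map $h\circ\_:\mathcal C(X,Y)\to\mathcal C(X,Z)$ is $R$-additive. A cartesian left $R$-additive category is one with finite products whose projections are $R$-additive. $\langle\cdots\rangle$ denotes tupling. Put $SX=X\times X$, $Sf=f\times f$, with projections $\pi_0,\pi_1:SX\to X$. A derivative is a family of operators $D:\mathcal C(X,Y)\to\mathcal C(SX,Y)$ such that: (i) $Dp=p\circ\pi_1$ for every product projection $p:X_0\times\cdots\times X_n\to X_i$; (ii) $D$ is $R$-additive; (iii) $D\,\mathrm{id}=\pi_1$ and $D(g\circ f)=Dg\circ\langle f\circ\pi_0,Df\rangle$; (iv) $Df$ is $R$-additive in its second argument, i.e. $u\mapsto Df\circ\langle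 x,u\rangle$ is $R$-additive; (v) $DDf\circ\langle\langle x,0\rangle,\langle 0,u\rangle\rangle=Df\circ\langle x,u\rangle$; (vi) $DDf\circ\langle\langle x,u\rangle,\langle v,w\rangle\rangle=DDf\circ\langle\langle x,v\rangle,\langle u,w\rangle\rangle$. A cartesian $R$-differential category is a cartesian left $R$-additive category with a derivative. The tangent functor $T:\mathcal C\to\mathcal C$ is $TX=SX$, $Tf=\langle f\circ\pi_0,Df\rangle$ (a functor by (iii)); $T^n$, $S^n$ are $n$-fold iterates, so $T^nX=S^nX$. For a word $w=w_1\cdots w_n\in\{0,1\}^n$ put $\pi_w=\pi_{w_1}\circ\cdots\circ\pi_{w_n}:S^nX\to X$ (so $\pi_{w_n}$, projecting the outermost $S$, is applied first). Let $\mathbf 0=0\cdots0$ be the zero word. A morphism into $S^nX$ is determined by its composites with all $\pi_w$, $w\in\{0,1\}^n$. Define $\iota^n_X:X\to S^nX$, $\theta^n_X:S^nS^nX\to S^nX$, $c^{n,m}_X:S^nS^mX\to S^mS^nX$ by - $\pi_w\circ\iota^n=\mathrm{id}$ if $w=\mathbf 0$, and $0$ otherwise; - $\pi_w\circ\theta^n=\sum\pi_{w^1}\circ\pi_{w^2}$, the sum over ordered pairs $(w^1,w^2)$ of words in $\{0,1\}^n$ with $w^1_i+w^2_i=w_i$ for all $i$ (either word may be $\mathbf 0$); - $\pi_u\circ\pi_v\circ c^{n,m}=\pi_v\circ\pi_u$ for $u\in\{0,1\}^n$, $v\in\{0,1\}^m$. A distributive law is meant in the sense of Beck (a natural transformation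 $T^nT^m\Rightarrow T^mT^n$ compatible with both units and both multiplications). -}

module Defs where

open import Level using (Level; _⊔_; suc)
open import Algebra.Bundles using (CommutativeSemiring)
open import Algebra.Module.Bundles using (Semimodule)
open import Algebra.Module.Structures using (IsSemimodule)
import Algebra.Module.Morphism.Structures as ModuleMorphisms
open import Data.Bool.Base using (if_then_else_)
open import Data.Fin.Base as Fin using (Fin; toℕ)
import Data.Fin.Properties as Fin
open import Data.Fin.Patterns using (0F; 1F)
open import Data.List.Base as List using (List; []; _∷_; length)
open import Data.Nat.Base as ℕ using (ℕ; zero)
import Data.Nat.Properties as ℕ
open import Data.Product.Base as Product using (_,_; proj₁; proj₂)
open import Data.Vec.Base as Vec using (Vec; []; _∷_)
import Data.Vec.Properties as Vec
open import Function.Base using (flip)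
open import Relation.Binary.Bundles using (Setoid)
open import Relation.Binary.Core using (Rel)
open import Relation.Binary.PropositionalEquality using (_≡_)
open import Relation.Binary.Structures using (IsEquivalence)
import Relation.Binary.Reasoning.Setoid as SetoidReasoning
open import Relation.Nullary.Decidable using (Dec; does)

private
  variable
    r ℓr o ℓ e : Level

record Category o ℓ e : Set (suc (o ⊔ ℓ ⊔ e)) where
  infix  4 _⇒_ _≈_
  infixr 9 _∘_
  field
    Obj : Set o
    _⇒_ : Obj → Obj → Set ℓ
    _≈_ : ∀ {X Y} → Rel (X ⇒ Y) e
    id  : ∀ {X} → X ⇒ X
    _∘_ : ∀ {X Y Z} → Y ⇒ Z → X ⇒ Y → X ⇒ Z

    isEquivalence : ∀ {X Y} → IsEquivalence (_≈_ {X} {Y})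
    ∘-cong    : ∀ {X Y Z} {g g′ : Y ⇒ Z} {f f′ : X ⇒ Y} →
                g ≈ g′ → f ≈ f′ → g ∘ f ≈ g′ ∘ f′
    assoc     : ∀ {W X Y Z} {f : W ⇒ X} {g : X ⇒ Y} {h : Y ⇒ Z} →
                (h ∘ g) ∘ f ≈ h ∘ (g ∘ f)
    identityˡ : ∀ {X Y} {f : X ⇒ Y} → id ∘ f ≈ f
    identityʳ : ∀ {X Y} {f : X ⇒ Y} → f ∘ id ≈ f

  hom-setoid : Obj → Obj → Setoid ℓ e
  hom-setoid X Y = record { isEquivalence = isEquivalence {X} {Y} }

  module Equiv {X Y} = IsEquivalence (isEquivalence {X} {Y})
  module HomReasoning {X Y} = SetoidReasoning (hom-setoid X Y)

record Endofunctor (C : Category o ℓ e) : Set (o ⊔ ℓ ⊔ e) where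
  open Category C
  field
    F₀ : Obj → Obj
    F₁ : ∀ {X Y} → X ⇒ Y → F₀ X ⇒ F₀ Y
    F-cong : ∀ {X Y} {f g : X ⇒ Y} → f ≈ g → F₁ f ≈ F₁ g
    F-id   : ∀ {X} → F₁ (id {X}) ≈ id
    F-∘    : ∀ {X Y Z} {f : X ⇒ Y} {g : Y ⇒ Z} → F₁ (g ∘ f) ≈ F₁ g ∘ F₁ f

module _ {C : Category o ℓ e} where
  open Category C

  infixr 9 _∘F_

  Id : Endofunctor C
  Id = record
    { F₀ = λ X → X
    ; F₁ = λ f → f
    ; F-cong = λ p → p
    ; F-id = Equiv.refl
    ; F-∘ = Equiv.refl
    }

  _∘F_ : Endofunctor C → Endofunctor C → Endofunctor C
  G ∘F F = record
    { F₀ = λ X → G.F₀ (F.F₀ X)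
    ; F₁ = λ f → G.F₁ (F.F₁ f)
    ; F-cong = λ p → G.F-cong (F.F-cong p)
    ; F-id = Equiv.trans (G.F-cong F.F-id) G.F-id
    ; F-∘ = Equiv.trans (G.F-cong F.F-∘) G.F-∘
    }
    where
    module F = Endofunctor F
    module G = Endofunctor G

-- Iterating on the inside lets π (a ∷ w) = π₍ a ₎ ∘ π w typecheck without
-- transport, with the outermost copy projected by the last letter.
iterate : ∀ {a} {A : Set a} → (A → A) → ℕ → A → A
iterate f zero      x = x
iterate f (ℕ.suc n) x = iterate f n (f x)

-- The object part is literally iterate F₀ n, so that (F ^F n) and the
-- iterated object operation agree definitionally for a variable n.
module _ {C : Category o ℓ e} (F : Endofunctor C) where
  open Category C
  open Endofunctor F

  iterate₁ : ∀ n {X Y} → X ⇒ Y → iterate F₀ n X ⇒ iterate F₀ n Y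
  iterate₁ zero      f = f
  iterate₁ (ℕ.suc n) f = iterate₁ n (F₁ f)

  iterate-cong : ∀ n {X Y} {f g : X ⇒ Y} → f ≈ g → iterate₁ n f ≈ iterate₁ n g
  iterate-cong zero      p = p
  iterate-cong (ℕ.suc n) p = iterate-cong n (F-cong p)

  iterate-id : ∀ n {X} → iterate₁ n (id {X}) ≈ id
  iterate-id zero      = Equiv.refl
  iterate-id (ℕ.suc n) = Equiv.trans (iterate-cong n F-id) (iterate-id n)

  iterate-∘ : ∀ n {X Y Z} {f : X ⇒ Y} {g : Y ⇒ Z} →
              iterate₁ n (g ∘ f) ≈ iterate₁ n g ∘ iterate₁ n f
  iterate-∘ zero      = Equiv.refl
  iterate-∘ (ℕ.suc n) = Equiv.trans (iterate-cong n F-∘) (iterate-∘ n)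

  infixl 10 _^F_

  _^F_ : ℕ → Endofunctor C
  _^F_ n = record
    { F₀ = iterate F₀ n
    ; F₁ = iterate₁ n
    ; F-cong = iterate-cong n
    ; F-id = iterate-id n
    ; F-∘ = iterate-∘ n
    }

module _ {C : Category o ℓ e} where
  open Category C
  open Endofunctor using (F₀; F₁)

  IsNatural : (F G : Endofunctor C) → (∀ X → F₀ F X ⇒ F₀ G X) → Set (o ⊔ ℓ ⊔ e)
  IsNatural F G α = ∀ {X Y} (f : X ⇒ Y) → α Y ∘ F₁ F f ≈ F₁ G f ∘ α X

  record IsMonad (M : Endofunctor C)
                 (η : ∀ X → X ⇒ F₀ M X)
                 (μ : ∀ X → F₀ M (F₀ M X) ⇒ F₀ M X) : Set (o ⊔ ℓ ⊔ e) where
    field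
      η-natural   : IsNatural Id M η
      μ-natural   : IsNatural (M ∘F M) M μ
      μ-assoc     : ∀ X → μ X ∘ F₁ M (μ X) ≈ μ X ∘ μ (F₀ M X)
      μ-identityˡ : ∀ X → μ X ∘ F₁ M (η X) ≈ id
      μ-identityʳ : ∀ X → μ X ∘ η (F₀ M X) ≈ id

  -- Distributive laws M N ⇒ N M of the monad M over the monad N.
  record IsDistributiveLaw
           {M N : Endofunctor C}
           {ηᴹ : ∀ X → X ⇒ F₀ M X} {μᴹ : ∀ X → F₀ M (F₀ M X) ⇒ F₀ M X}
           {ηᴺ : ∀ X → X ⇒ F₀ N X} {μᴺ : ∀ X → F₀ N (F₀ N X) ⇒ F₀ N X}
           (M-isMonad : IsMonad M ηᴹ μᴹ) (N-isMonad : IsMonad N ηᴺ μᴺ)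
           (δ : ∀ X → F₀ M (F₀ N X) ⇒ F₀ N (F₀ M X)) : Set (o ⊔ ℓ ⊔ e) where
    field
      natural : IsNatural (M ∘F N) (N ∘F M) δ
      unitᴹ   : ∀ X → δ X ∘ ηᴹ (F₀ N X) ≈ F₁ N (ηᴹ X)
      unitᴺ   : ∀ X → δ X ∘ F₁ M (ηᴺ X) ≈ ηᴺ (F₀ M X)
      multᴹ   : ∀ X → δ X ∘ μᴹ (F₀ N X) ≈
                      F₁ N (μᴹ X) ∘ δ (F₀ M X) ∘ F₁ M (δ X)
      multᴺ   : ∀ X → δ X ∘ F₁ M (μᴺ X) ≈
                      μᴺ (F₀ M X) ∘ F₁ N (δ X) ∘ δ (F₀ N X)

record FiniteProducts (C : Category o ℓ e) : Set (o ⊔ ℓ ⊔ e) where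
  open Category C
  infixr 7 _×_
  field
    ⊤        : Obj
    !        : ∀ {X} → X ⇒ ⊤
    !-unique : ∀ {X} (f : X ⇒ ⊤) → ! ≈ f

    _×_   : Obj → Obj → Obj
    π₀    : ∀ {X Y} → X × Y ⇒ X
    π₁    : ∀ {X Y} → X × Y ⇒ Y
    ⟨_,_⟩ : ∀ {X Y Z} → Z ⇒ X → Z ⇒ Y → Z ⇒ X × Y

    project₀ : ∀ {X Y Z} {f : Z ⇒ X} {g : Z ⇒ Y} → π₀ ∘ ⟨ f , g ⟩ ≈ f
    project₁ : ∀ {X Y Z} {f : Z ⇒ X} {g : Z ⇒ Y} → π₁ ∘ ⟨ f , g ⟩ ≈ g
    unique   : ∀ {X Y Z} {f : Z ⇒ X} {g : Z ⇒ Y} {h : Z ⇒ X × Y} →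
               π₀ ∘ h ≈ f → π₁ ∘ h ≈ g → ⟨ f , g ⟩ ≈ h

  -- ∏ X₀ (X₁ ∷ ⋯ ∷ Xₙ ∷ []) = X₀ × (X₁ × ⋯ × Xₙ)
  ∏ : Obj → List Obj → Obj
  ∏ X []       = X
  ∏ X (Y ∷ Ys) = X × ∏ Y Ys

  proj : ∀ X Xs (i : Fin (ℕ.suc (length Xs))) → ∏ X Xs ⇒ List.lookup (X ∷ Xs) i
  proj X []       Fin.zero    = id
  proj X (Y ∷ Ys) Fin.zero    = π₀
  proj X (Y ∷ Ys) (Fin.suc i) = proj Y Ys i ∘ π₁

  S : Obj → Obj
  S X = X × X

module _ (R : CommutativeSemiring r ℓr) where
  private module R = CommutativeSemiring R

  record LeftAdditive (C : Category o ℓ e) : Set (r ⊔ ℓr ⊔ o ⊔ ℓ ⊔ e) where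
    open Category C
    infixl 6 _+_
    infixr 7 _·_
    field
      _+_ : ∀ {X Y} → X ⇒ Y → X ⇒ Y → X ⇒ Y
      𝟘   : ∀ {X Y} → X ⇒ Y
      _·_ : ∀ {X Y} → R.Carrier → X ⇒ Y → X ⇒ Y
      isSemimodule : ∀ {X Y} →
        IsSemimodule R (_≈_ {X} {Y}) _+_ 𝟘 _·_ (flip _·_)

    hom : Obj → Obj → Semimodule R ℓ e
    hom X Y = record { isSemimodule = isSemimodule {X} {Y} }

    IsAdditiveMap : ∀ {W X Y Z} → (W ⇒ X → Y ⇒ Z) → Set (r ⊔ ℓ ⊔ e)
    IsAdditiveMap {W} {X} {Y} {Z} =
      ModuleMorphisms.SemimoduleMorphisms.IsSemimoduleHomomorphism
        (Semimodule.rawSemimodule (hom W X)) (Semimodule.rawSemimodule (hom Y Z))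

    IsAdditive : ∀ {Y Z} → Y ⇒ Z → Set (r ⊔ o ⊔ ℓ ⊔ e)
    IsAdditive {Y} h = ∀ {X} → IsAdditiveMap (λ (f : X ⇒ Y) → h ∘ f)

    field
      precomp-additive : ∀ {X Y Z} (f : X ⇒ Y) →
        IsAdditiveMap (λ (g : Y ⇒ Z) → g ∘ f)

    sum : ∀ {X Y} → List (X ⇒ Y) → X ⇒ Y
    sum = List.foldr _+_ 𝟘

  record CartesianLeftAdditiveCategory o ℓ e : Set (r ⊔ ℓr ⊔ suc (o ⊔ ℓ ⊔ e)) where
    field
      category     : Category o ℓ e
      leftAdditive : LeftAdditive category
      products     : FiniteProducts category

    open Category category public
    open LeftAdditive leftAdditive public
    open FiniteProducts products public

    field
      proj-additive : ∀ X Xs i → IsAdditive (proj X Xs i)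

  record Derivative (C : CartesianLeftAdditiveCategory o ℓ e)
         : Set (r ⊔ o ⊔ ℓ ⊔ e) where
    open CartesianLeftAdditiveCategory C
    field
      D          : ∀ {X Y} → X ⇒ Y → S X ⇒ Y
      D-proj     : ∀ X Xs i → D (proj X Xs i) ≈ proj X Xs i ∘ π₁
      D-additive : ∀ {X Y} → IsAdditiveMap (λ (f : X ⇒ Y) → D f)
      D-id       : ∀ {X} → D (id {X}) ≈ π₁
      D-∘        : ∀ {X Y Z} (f : X ⇒ Y) (g : Y ⇒ Z) →
                   D (g ∘ f) ≈ D g ∘ ⟨ f ∘ π₀ , D f ⟩
      D-additive₂ : ∀ {X Y Z} (f : X ⇒ Y) (x : Z ⇒ X) →
                    IsAdditiveMap (λ (u : Z ⇒ X) → D f ∘ ⟨ x , u ⟩)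
      D-linear   : ∀ {X Y Z} (f : X ⇒ Y) (x u : Z ⇒ X) →
                   D (D f) ∘ ⟨ ⟨ x , 𝟘 ⟩ , ⟨ 𝟘 , u ⟩ ⟩ ≈ D f ∘ ⟨ x , u ⟩
      D-symmetric : ∀ {X Y Z} (f : X ⇒ Y) (x u v w : Z ⇒ X) →
                   D (D f) ∘ ⟨ ⟨ x , u ⟩ , ⟨ v , w ⟩ ⟩ ≈
                   D (D f) ∘ ⟨ ⟨ x , v ⟩ , ⟨ u , w ⟩ ⟩

  record CartesianDifferentialCategory o ℓ e : Set (r ⊔ ℓr ⊔ suc (o ⊔ ℓ ⊔ e)) where
    field
      cartesianLeftAdditive : CartesianLeftAdditiveCategory o ℓ e
      derivative            : Derivative cartesianLeftAdditive

    open CartesianLeftAdditiveCategory cartesianLeftAdditive public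
    open Derivative derivative public

Word : ℕ → Set
Word = Vec (Fin 2)

𝟎 : ∀ {n} → Word n
𝟎 = Vec.replicate _ 0F

_≟_ : ∀ {n} (v w : Word n) → Dec (v ≡ w)
_≟_ = Vec.≡-dec Fin._≟_

words : ∀ n → List (Word n)
words zero      = [] ∷ []
words (ℕ.suc n) = List.map (0F ∷_) (words n) List.++ List.map (1F ∷_) (words n)

-- Letters are added in ℕ, so two letters 1F in the same place never match.
SumsTo : ∀ {n} → Word n → Word n Product.× Word n → Set
SumsTo w (w¹ , w²) =
  ∀ i → toℕ (Vec.lookup w¹ i) ℕ.+ toℕ (Vec.lookup w² i) ≡ toℕ (Vec.lookup w i)

sumsTo? : ∀ {n} (w : Word n) p → Dec (SumsTo w p)
sumsTo? w (w¹ , w²) = Fin.all? λ i →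
  toℕ (Vec.lookup w¹ i) ℕ.+ toℕ (Vec.lookup w² i) ℕ.≟ toℕ (Vec.lookup w i)

decompositions : ∀ {n} → Word n → List (Word n Product.× Word n)
decompositions {n} w =
  List.filter (sumsTo? w) (List.cartesianProduct (words n) (words n))

module Tangent {R : CommutativeSemiring r ℓr}
               (C : CartesianDifferentialCategory R o ℓ e) where

  open CartesianDifferentialCategory C

  private
    module D {X Y} = ModuleMorphisms.SemimoduleMorphisms.IsSemimoduleHomomorphism
                       (D-additive {X} {Y})

  ⟨⟩-cong : ∀ {X Y Z} {f f′ : Z ⇒ X} {g g′ : Z ⇒ Y} →
            f ≈ f′ → g ≈ g′ → ⟨ f , g ⟩ ≈ ⟨ f′ , g′ ⟩
  ⟨⟩-cong p q = unique (Equiv.trans project₀ (Equiv.sym p))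
                       (Equiv.trans project₁ (Equiv.sym q))

  ⟨⟩∘ : ∀ {W X Y Z} {f : Z ⇒ X} {g : Z ⇒ Y} {h : W ⇒ Z} →
        ⟨ f ∘ h , g ∘ h ⟩ ≈ ⟨ f , g ⟩ ∘ h
  ⟨⟩∘ = unique (Equiv.trans (Equiv.sym assoc) (∘-cong project₀ Equiv.refl))
               (Equiv.trans (Equiv.sym assoc) (∘-cong project₁ Equiv.refl))

  T₁ : ∀ {X Y} → X ⇒ Y → S X ⇒ S Y
  T₁ f = ⟨ f ∘ π₀ , D f ⟩

  T : Endofunctor category
  T = record
    { F₀ = S
    ; F₁ = T₁
    ; F-cong = λ p → ⟨⟩-cong (∘-cong p Equiv.refl) (D.⟦⟧-cong p)
    ; F-id = unique (Equiv.trans identityʳ (Equiv.sym identityˡ))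
                    (Equiv.trans identityʳ (Equiv.sym D-id))
    ; F-∘ = λ {_} {_} {_} {f} {g} →
        Equiv.trans
          (⟨⟩-cong
            (Equiv.trans assoc
              (Equiv.trans (∘-cong Equiv.refl (Equiv.sym project₀))
                           (Equiv.sym assoc)))
            (D-∘ f g))
          ⟨⟩∘
    }

  S^ : ℕ → Obj → Obj
  S^ = iterate S

  π₍_₎ : Fin 2 → ∀ {X} → S X ⇒ X
  π₍ 0F ₎ = π₀
  π₍ 1F ₎ = π₁

  π : ∀ {n} (w : Word n) X → S^ n X ⇒ X
  π []      X = id
  π (a ∷ w) X = π₍ a ₎ ∘ π w (S X)

  -- The morphism into S^ n X with prescribed composites with all π w.
  tuple : ∀ n {X Z} → (Word n → Z ⇒ X) → Z ⇒ S^ n X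
  tuple zero      h = h []
  tuple (ℕ.suc n) h = tuple n λ w → ⟨ h (0F ∷ w) , h (1F ∷ w) ⟩

  π-tuple : ∀ n {X Z} (h : Word n → Z ⇒ X) w → π w X ∘ tuple n h ≈ h w
  π-tuple zero      h []       = identityˡ
  π-tuple (ℕ.suc n) h (0F ∷ w) =
    Equiv.trans assoc (Equiv.trans (∘-cong Equiv.refl (π-tuple n _ w)) project₀)
  π-tuple (ℕ.suc n) h (1F ∷ w) =
    Equiv.trans assoc (Equiv.trans (∘-cong Equiv.refl (π-tuple n _ w)) project₁)

  π-jointly-monic : ∀ n {X Z} (f g : Z ⇒ S^ n X) →
                    (∀ (w : Word n) → π w X ∘ f ≈ π w X ∘ g) → f ≈ g
  π-jointly-monic zero      f g p =
    Equiv.trans (Equiv.sym identityˡ) (Equiv.trans (p []) identityˡ)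
  π-jointly-monic (ℕ.suc n) {X} f g p = π-jointly-monic n f g λ w →
    Equiv.trans
      (Equiv.sym (unique (Equiv.trans (Equiv.sym assoc) (p (0F ∷ w)))
                         (Equiv.trans (Equiv.sym assoc) (p (1F ∷ w)))))
      (unique (Equiv.sym assoc) (Equiv.sym assoc))

  ι : ∀ n X → X ⇒ S^ n X
  ι n X = tuple n λ w → if does (w ≟ 𝟎) then id else 𝟘

  θ : ∀ n X → S^ n (S^ n X) ⇒ S^ n X
  θ n X = tuple n λ w →
    sum (List.map (λ (w¹ , w²) → π w¹ X ∘ π w² (S^ n X)) (decompositions w))

  c : ∀ n m X → S^ n (S^ m X) ⇒ S^ m (S^ n X)
  c n m X = tuple m λ v → tuple n λ u → π v X ∘ π u (S^ m X)

{-# OPTIONS --safe #-}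
module Submission where

-- Call h linear if D h = h ∘ π₁. A linear h is additive, and T^n h acts
-- componentwise: π_w ∘ T^n h = h ∘ π_w. Since ι, θ and c are linear, every
-- monad and distributive-law equation can be compared on components π_w, where
-- it becomes an identity of convolution sums over letterwise decompositions of
-- words. Naturality is reduced to n = m = 1 by expressing ι, θ, c for n + 1
-- through those for n and 1, e.g. θ^{n+1} = T^n θ^1 ∘ θ^n ∘ T^n c^{1,n}; for
-- n = m = 1 it is additivity of D f in its second argument (ι, θ) and the
-- symmetry of D (D f) (c).

open import Defs
open import Algebra.Bundles using (CommutativeMonoid; CommutativeSemiring)
open import Algebra.Module.Bundles using (Semimodule)
import Algebra.Module.Morphism.Structures as ModuleMorphisms
import Algebra.Properties.CommutativeSemigroup as CommutativeSemigroupProperties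
open import Data.Bool.Base using (true; false; if_then_else_)
open import Data.Fin.Patterns using (0F; 1F)
open import Data.List.Base as List using (List; []; _∷_; _++_)
open import Data.Nat.Base using (ℕ; zero; suc)
open import Data.Product.Base using (Σ-syntax; _×_; _,_)
open import Data.Vec.Base using ([]; _∷_)
open import Level using (Level)
open import Relation.Nullary.Decidable using (does)
open import Relation.Unary using (Pred; Decidable)

-- Finite sums of morphisms and convolution over words.

module Sums {r ℓr o ℓ e} {R : CommutativeSemiring r ℓr} {C : Category o ℓ e}
            (A : LeftAdditive R C) where
  open Category C
  open Equiv using (refl; sym; trans)
  open LeftAdditive A
  open HomReasoning

  private
    module Hom {X Y} = Semimodule (hom X Y)
    module Precomp {X Y Z} (f : X ⇒ Y) =
      ModuleMorphisms.SemimoduleMorphisms.IsSemimoduleHomomorphism (precomp-additive {X} {Y} {Z} f)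

    variable
      X Y Z : Obj
      a p : Level
      B : Set a
      n : ℕ

  open module HomInterchange {X Y} =
    CommutativeSemigroupProperties
      (CommutativeMonoid.commutativeSemigroup (Hom.+ᴹ-commutativeMonoid {X} {Y}))
    using (interchange)
  open Hom public using () renaming
    ( +ᴹ-cong to +-cong; +ᴹ-assoc to +-assoc; +ᴹ-comm to +-comm
    ; +ᴹ-identityˡ to +-identityˡ; +ᴹ-identityʳ to +-identityʳ )

  +-∘ : {f g : Y ⇒ Z} {h : X ⇒ Y} → (f + g) ∘ h ≈ f ∘ h + g ∘ h
  +-∘ {h = h} = Precomp.+ᴹ-homo h _ _

  𝟘-∘ : {h : X ⇒ Y} → 𝟘 {Y} {Z} ∘ h ≈ 𝟘
  𝟘-∘ {h = h} = Precomp.0ᴹ-homo h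

  ∑ : List B → (B → X ⇒ Y) → X ⇒ Y
  ∑ xs f = sum (List.map f xs)

  ∑-cong : ∀ (xs : List B) {f g : B → X ⇒ Y} → (∀ x → f x ≈ g x) → ∑ xs f ≈ ∑ xs g
  ∑-cong []       p = refl
  ∑-cong (x ∷ xs) p = +-cong (p x) (∑-cong xs p)

  ∑-𝟘 : ∀ (xs : List B) → ∑ xs (λ _ → 𝟘 {X} {Y}) ≈ 𝟘
  ∑-𝟘 []       = refl
  ∑-𝟘 (x ∷ xs) = trans (+-identityˡ _) (∑-𝟘 xs)

  ∑-++ : ∀ (xs ys : List B) (f : B → X ⇒ Y) → ∑ (xs ++ ys) f ≈ ∑ xs f + ∑ ys f
  ∑-++ []       ys f = sym (+-identityˡ _)
  ∑-++ (x ∷ xs) ys f = trans (+-cong refl (∑-++ xs ys f)) (sym (+-assoc _ _ _))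

  ∑-map : ∀ {b} {B′ : Set b} (h : B → B′) xs (f : B′ → X ⇒ Y) →
          ∑ (List.map h xs) f ≈ ∑ xs (λ x → f (h x))
  ∑-map h []       f = refl
  ∑-map h (x ∷ xs) f = +-cong refl (∑-map h xs f)

  -- With rejected entries kept as zero summands, the index set becomes a full product, which can be
  -- split by first letters.
  ∑-filter : ∀ {P : Pred B p} (P? : Decidable P) xs (f : B → X ⇒ Y) →
             ∑ (List.filter P? xs) f ≈ ∑ xs (λ x → if does (P? x) then f x else 𝟘)
  ∑-filter P? []       f = refl
  ∑-filter P? (x ∷ xs) f with does (P? x)
  ... | true  = +-cong refl (∑-filter P? xs f)
  ... | false = trans (∑-filter P? xs f) (sym (+-identityˡ _))

  ∑-cartesianProduct : ∀ {b} {B′ : Set b} (xs : List B) (ys : List B′) (f : B × B′ → X ⇒ Y) →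
    ∑ (List.cartesianProduct xs ys) f ≈ ∑ xs (λ x → ∑ ys (λ y → f (x , y)))
  ∑-cartesianProduct []       ys f = refl
  ∑-cartesianProduct (x ∷ xs) ys f =
    trans (∑-++ (List.map (x ,_) ys) _ f)
          (+-cong (∑-map (x ,_) ys f) (∑-cartesianProduct xs ys f))

  ∑-words : ∀ n (f : Word (suc n) → X ⇒ Y) →
    ∑ (words (suc n)) f ≈ ∑ (words n) (λ w → f (0F ∷ w)) + ∑ (words n) (λ w → f (1F ∷ w))
  ∑-words n f = trans (∑-++ (List.map (0F ∷_) (words n)) _ f)
                      (+-cong (∑-map _ (words n) f) (∑-map _ (words n) f))

  -- The sum over decompositions w, recursively in w.
  ⨁ : Word n → (Word n → Word n → X ⇒ Y) → X ⇒ Y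
  ⨁ []       g = g [] []
  ⨁ (0F ∷ w) g = ⨁ w (λ u v → g (0F ∷ u) (0F ∷ v))
  ⨁ (1F ∷ w) g = ⨁ w (λ u v → g (0F ∷ u) (1F ∷ v)) + ⨁ w (λ u v → g (1F ∷ u) (0F ∷ v))

  private
    ∑∑ : Word n → (Word n → Word n → X ⇒ Y) → X ⇒ Y
    ∑∑ {n} w g =
      ∑ (words n) λ u → ∑ (words n) λ v → if does (sumsTo? w (u , v)) then g u v else 𝟘

    -- Of the four choices of first letters for `u` and `v`, those that do not add up to the first
    -- letter of `w` make the test compute to `false` and leave sums of `𝟘`. For the others the test
    -- reduces to the one on the tails.
    ∑∑-⨁ : ∀ (w : Word n) (g : Word n → Word n → X ⇒ Y) → ∑∑ w g ≈ ⨁ w g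
    ∑∑-⨁ [] g = trans (+-identityʳ _) (+-identityʳ _)
    ∑∑-⨁ {suc n} (0F ∷ w) g = begin
      ∑∑ (0F ∷ w) g
        ≈⟨ ∑-words n _ ⟩
      _ ≈⟨ +-cong
             (∑-cong (words n) λ u → trans (∑-words n _)
               (trans (+-cong refl (∑-𝟘 (words n))) (+-identityʳ _)))
             (trans (∑-cong (words n) λ u → trans (∑-words n _)
                      (trans (+-cong (∑-𝟘 (words n)) (∑-𝟘 (words n))) (+-identityʳ _)))
                    (∑-𝟘 (words n))) ⟩
      _ ≈⟨ +-identityʳ _ ⟩
      ∑∑ w (λ u v → g (0F ∷ u) (0F ∷ v))
        ≈⟨ ∑∑-⨁ w _ ⟩
      ⨁ (0F ∷ w) g ∎
    ∑∑-⨁ {suc n} (1F ∷ w) g = begin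
      ∑∑ (1F ∷ w) g
        ≈⟨ ∑-words n _ ⟩
      _ ≈⟨ +-cong
             (∑-cong (words n) λ u → trans (∑-words n _)
               (trans (+-cong (∑-𝟘 (words n)) refl) (+-identityˡ _)))
             (∑-cong (words n) λ u → trans (∑-words n _)
               (trans (+-cong refl (∑-𝟘 (words n))) (+-identityʳ _))) ⟩
      ∑∑ w (λ u v → g (0F ∷ u) (1F ∷ v)) + ∑∑ w (λ u v → g (1F ∷ u) (0F ∷ v))
        ≈⟨ +-cong (∑∑-⨁ w _) (∑∑-⨁ w _) ⟩
      ⨁ (1F ∷ w) g ∎

  ∑-decompositions : ∀ (w : Word n) (g : Word n → Word n → X ⇒ Y) →
    ∑ (decompositions w) (λ (u , v) → g u v) ≈ ⨁ w g
  ∑-decompositions {n} w g =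
    trans (∑-filter (sumsTo? w) (List.cartesianProduct (words n) (words n)) _)
      (trans (∑-cartesianProduct (words n) (words n) _) (∑∑-⨁ w g))

  ⨁-cong : ∀ (w : Word n) {f g : Word n → Word n → X ⇒ Y} →
           (∀ u v → f u v ≈ g u v) → ⨁ w f ≈ ⨁ w g
  ⨁-cong []       p = p [] []
  ⨁-cong (0F ∷ w) p = ⨁-cong w λ u v → p _ _
  ⨁-cong (1F ∷ w) p = +-cong (⨁-cong w λ u v → p _ _) (⨁-cong w λ u v → p _ _)

  ⨁-𝟘 : ∀ (w : Word n) → ⨁ w (λ _ _ → 𝟘 {X} {Y}) ≈ 𝟘
  ⨁-𝟘 []       = refl
  ⨁-𝟘 (0F ∷ w) = ⨁-𝟘 w
  ⨁-𝟘 (1F ∷ w) = trans (+-cong (⨁-𝟘 w) (⨁-𝟘 w)) (+-identityˡ _)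

  ⨁-+ : ∀ (w : Word n) {f g : Word n → Word n → X ⇒ Y} →
        ⨁ w (λ u v → f u v + g u v) ≈ ⨁ w f + ⨁ w g
  ⨁-+ []       = refl
  ⨁-+ (0F ∷ w) = ⨁-+ w
  ⨁-+ (1F ∷ w) = trans (+-cong (⨁-+ w) (⨁-+ w)) (interchange _ _ _ _)

  -- Both sides run over the ways to give each letter `1F` of `w` to one of three words. A leading
  -- `1F` produces the same three summands in the same order, bracketed differently.
  ⨁-assoc : ∀ (w : Word n) {g : Word n → Word n → Word n → X ⇒ Y} →
            ⨁ w (λ s z → ⨁ s (λ x y → g x y z)) ≈ ⨁ w (λ x s → ⨁ s (λ y z → g x y z))
  ⨁-assoc []       = refl
  ⨁-assoc (0F ∷ w) = ⨁-assoc w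
  ⨁-assoc (1F ∷ w) = begin
    _ ≈⟨ +-cong (⨁-assoc w) (trans (⨁-+ w) (+-cong (⨁-assoc w) (⨁-assoc w))) ⟩
    _ ≈⟨ +-assoc _ _ _ ⟨
    _ ≈⟨ +-cong (⨁-+ w) refl ⟨
    _ ∎

  ⨁-∘ : ∀ (w : Word n) {g : Word n → Word n → Y ⇒ Z} {h : X ⇒ Y} →
        ⨁ w g ∘ h ≈ ⨁ w (λ u v → g u v ∘ h)
  ⨁-∘ []       = refl
  ⨁-∘ (0F ∷ w) = ⨁-∘ w
  ⨁-∘ (1F ∷ w) = trans +-∘ (+-cong (⨁-∘ w) (⨁-∘ w))

  -- The unit for the convolution `⨁`. The body repeats the one in `ι`, so that `δ w id` is the
  -- component of `ι n X` at `w`.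
  δ : Word n → X ⇒ Y → X ⇒ Y
  δ w f = if does (w ≟ 𝟎) then f else 𝟘

  δ-cong : ∀ (w : Word n) {f g : X ⇒ Y} → f ≈ g → δ w f ≈ δ w g
  δ-cong w p with does (w ≟ 𝟎)
  ... | true  = p
  ... | false = refl

  δ-𝟘 : ∀ (w : Word n) → δ w (𝟘 {X} {Y}) ≈ 𝟘
  δ-𝟘 w with does (w ≟ 𝟎)
  ... | true  = refl
  ... | false = refl

  δ-∘ : ∀ (w : Word n) {g : Y ⇒ Z} {h : X ⇒ Y} → δ w g ∘ h ≈ δ w (g ∘ h)
  δ-∘ w with does (w ≟ 𝟎)
  ... | true  = refl
  ... | false = 𝟘-∘

  -- Only `u = 𝟎` contributes: `δ (1F ∷ u)` computes to `𝟘`, so every letter `1F` of `w` has to go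
  -- to `v`.
  ⨁-identityˡ : ∀ (w : Word n) {g : Word n → X ⇒ Y} → ⨁ w (λ u v → δ u (g v)) ≈ g w
  ⨁-identityˡ []       = refl
  ⨁-identityˡ (0F ∷ w) = ⨁-identityˡ w
  ⨁-identityˡ (1F ∷ w) = trans (+-cong (⨁-identityˡ w) (⨁-𝟘 w)) (+-identityʳ _)

  ⨁-identityʳ : ∀ (w : Word n) {g : Word n → X ⇒ Y} → ⨁ w (λ u v → δ v (g u)) ≈ g w
  ⨁-identityʳ []       = refl
  ⨁-identityʳ (0F ∷ w) = ⨁-identityʳ w
  ⨁-identityʳ (1F ∷ w) = trans (+-cong (⨁-𝟘 w) (⨁-identityʳ w)) (+-identityˡ _)

module Properties {r ℓr o ℓ e} {R : CommutativeSemiring r ℓr}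
                  (C : CartesianDifferentialCategory R o ℓ e) where
  open CartesianDifferentialCategory C hiding (_×_)
  open Equiv using (refl; sym; trans)
  open HomReasoning
  open Sums leftAdditive
  open Tangent C

  private
    variable
      W X Y Z X′ Y′ Z′ : Obj
      n : ℕ

    module D {X Y} =
      ModuleMorphisms.SemimoduleMorphisms.IsSemimoduleHomomorphism (D-additive {X} {Y})
    module D₂ {X Y Z} (f : X ⇒ Y) (x : Z ⇒ X) =
      ModuleMorphisms.SemimoduleMorphisms.IsSemimoduleHomomorphism (D-additive₂ f x)

  -- Rewriting inside composites.

  infixr 4 refl⟩∘⟨_
  infix  5 _⟩∘⟨refl

  refl⟩∘⟨_ : {h : Y ⇒ Z} {f g : X ⇒ Y} → f ≈ g → h ∘ f ≈ h ∘ g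
  refl⟩∘⟨ p = ∘-cong refl p

  _⟩∘⟨refl : {h : X ⇒ Y} {f g : Y ⇒ Z} → f ≈ g → f ∘ h ≈ g ∘ h
  p ⟩∘⟨refl = ∘-cong p refl

  pullˡ : {f : W ⇒ X} {g : X ⇒ Y} {h : Y ⇒ Z} {k : X ⇒ Z} → h ∘ g ≈ k → h ∘ g ∘ f ≈ k ∘ f
  pullˡ p = trans (sym assoc) (p ⟩∘⟨refl)

  pullʳ : {f : W ⇒ X} {g : X ⇒ Y} {h : Y ⇒ Z} {k : W ⇒ Y} → g ∘ f ≈ k → (h ∘ g) ∘ f ≈ h ∘ k
  pullʳ p = trans assoc (refl⟩∘⟨ p)

  extendˡ : {f : W ⇒ X} {g : X ⇒ Y} {h : Y ⇒ Z} {g′ : X ⇒ Y′} {h′ : Y′ ⇒ Z} →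
            h ∘ g ≈ h′ ∘ g′ → h ∘ g ∘ f ≈ h′ ∘ g′ ∘ f
  extendˡ p = trans (pullˡ p) assoc

  -- Pasting of commuting squares: it yields naturality of a composite from naturality of its
  -- factors.
  glue : {f : X ⇒ X′} {g : Y ⇒ Y′} {h : Z ⇒ Z′}
         {a : X ⇒ Y} {a′ : X′ ⇒ Y′} {b : Y ⇒ Z} {b′ : Y′ ⇒ Z′} →
         b′ ∘ g ≈ h ∘ b → a′ ∘ f ≈ g ∘ a → (b′ ∘ a′) ∘ f ≈ h ∘ b ∘ a
  glue p q = trans (pullʳ q) (extendˡ p)

  -- Serves the base cases of the naturality inductions, where `c` and `θ` are identities.
  ≈id-commute : {a : X ⇒ X} {b : Y ⇒ Y} {f : X ⇒ Y} → b ≈ id → a ≈ id → b ∘ f ≈ f ∘ a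
  ≈id-commute p q =
    trans (p ⟩∘⟨refl) (trans identityˡ (trans (sym identityʳ) (refl⟩∘⟨ sym q)))

  -- Linear morphisms

  IsLinear : X ⇒ Y → Set e
  IsLinear h = D h ≈ h ∘ π₁

  linear-resp : {f g : X ⇒ Y} → f ≈ g → IsLinear f → IsLinear g
  linear-resp p l = trans (D.⟦⟧-cong (sym p)) (trans l (p ⟩∘⟨refl))

  linear-∘ : {f : X ⇒ Y} {g : Y ⇒ Z} → IsLinear g → IsLinear f → IsLinear (g ∘ f)
  linear-∘ {f = f} {g} lg lf = begin
    D (g ∘ f)                   ≈⟨ D-∘ f g ⟩
    D g ∘ ⟨ f ∘ π₀ , D f ⟩      ≈⟨ lg ⟩∘⟨refl ⟩
    (g ∘ π₁) ∘ ⟨ f ∘ π₀ , D f ⟩ ≈⟨ pullʳ project₁ ⟩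
    g ∘ D f                     ≈⟨ refl⟩∘⟨ lf ⟩
    g ∘ f ∘ π₁                  ≈⟨ assoc ⟨
    (g ∘ f) ∘ π₁                ∎

  linear-π₍₎ : ∀ a → IsLinear (π₍ a ₎ {X})
  linear-π₍₎ {X} 0F = D-proj X (X ∷ []) 0F
  -- The last projection of a binary product is given by `proj` as `id ∘ π₁`.
  linear-π₍₎ {X} 1F = linear-resp identityˡ (D-proj X (X ∷ []) 1F)

  linear-π : (w : Word n) → IsLinear (π w X)
  linear-π []      = trans D-id (sym identityˡ)
  linear-π (a ∷ w) = linear-∘ (linear-π₍₎ a) (linear-π w)

  D-π₍₎∘ : ∀ a (f : X ⇒ S Y) → D (π₍ a ₎ ∘ f) ≈ π₍ a ₎ ∘ D f
  D-π₍₎∘ a f = trans (D-∘ f π₍ a ₎) (trans (linear-π₍₎ a ⟩∘⟨refl) (pullʳ project₁))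

  -- Projections are linear, so `D` commutes with postcomposition by them, and a map into a product
  -- is determined by its projections.
  D-⟨⟩ : {f g : X ⇒ Y} → D ⟨ f , g ⟩ ≈ ⟨ D f , D g ⟩
  D-⟨⟩ = sym (unique (trans (sym (D-π₍₎∘ 0F _)) (D.⟦⟧-cong project₀))
                     (trans (sym (D-π₍₎∘ 1F _)) (D.⟦⟧-cong project₁)))

  linear-⟨⟩ : {f g : X ⇒ Y} → IsLinear f → IsLinear g → IsLinear ⟨ f , g ⟩
  linear-⟨⟩ lf lg = trans D-⟨⟩ (trans (⟨⟩-cong lf lg) ⟨⟩∘)

  linear-𝟘 : IsLinear (𝟘 {X} {Y})
  linear-𝟘 = trans D.0ᴹ-homo (sym 𝟘-∘)

  linear-+ : {f g : X ⇒ Y} → IsLinear f → IsLinear g → IsLinear (f + g)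
  linear-+ lf lg = trans (D.+ᴹ-homo _ _) (trans (+-cong lf lg) (sym +-∘))

  linear-∑ : ∀ {a} {B : Set a} (xs : List B) {f : B → X ⇒ Y} →
             (∀ x → IsLinear (f x)) → IsLinear (∑ xs f)
  linear-∑ []       l = linear-𝟘
  linear-∑ (x ∷ xs) l = linear-+ (l x) (linear-∑ xs l)

  linear-δ : (w : Word n) {f : X ⇒ Y} → IsLinear f → IsLinear (δ w f)
  linear-δ w l with does (w ≟ 𝟎)
  ... | true  = l
  ... | false = linear-𝟘

  linear-tuple : ∀ n {h : Word n → Z ⇒ X} → (∀ w → IsLinear (h w)) → IsLinear (tuple n h)
  linear-tuple zero    l = l []
  linear-tuple (suc n) l = linear-tuple n λ w → linear-⟨⟩ (l _) (l _)

  -- The second entry `D h` of `T₁ h` is `h ∘ π₁` by hypothesis, hence a composite of linear maps.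
  linear-T₁ : {h : X ⇒ Y} → IsLinear h → IsLinear (T₁ h)
  linear-T₁ l = linear-⟨⟩ (linear-∘ l (linear-π₍₎ 0F))
                          (linear-resp (sym l) (linear-∘ l (linear-π₍₎ 1F)))

  linear-ι : ∀ n → IsLinear (ι n X)
  linear-ι n = linear-tuple n λ w → linear-δ w (linear-π [])

  linear-θ : ∀ n → IsLinear (θ n X)
  linear-θ n = linear-tuple n λ w → linear-∑ (decompositions w) λ (u , v) →
    linear-∘ (linear-π u) (linear-π v)

  linear-c : ∀ n m → IsLinear (c n m X)
  linear-c n m = linear-tuple m λ v → linear-tuple n λ u → linear-∘ (linear-π v) (linear-π u)

  -- The first argument of the derivative is irrelevant for a linear h, so that
  -- additivity in the second argument makes h itself additive.
  D-linear₂ : {h : X ⇒ Y} {u : Z ⇒ X} → IsLinear h → D h ∘ ⟨ 𝟘 , u ⟩ ≈ h ∘ u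
  D-linear₂ l = trans (l ⟩∘⟨refl) (pullʳ project₁)

  linear⇒∘-𝟘 : {h : X ⇒ Y} → IsLinear h → h ∘ 𝟘 {Z} ≈ 𝟘
  linear⇒∘-𝟘 {h = h} l = trans (sym (D-linear₂ l)) (D₂.0ᴹ-homo h 𝟘)

  linear⇒∘-+ : {h : X ⇒ Y} {u v : Z ⇒ X} → IsLinear h → h ∘ (u + v) ≈ h ∘ u + h ∘ v
  linear⇒∘-+ {h = h} {u} {v} l =
    trans (sym (D-linear₂ l))
      (trans (D₂.+ᴹ-homo h 𝟘 u v) (+-cong (D-linear₂ l) (D-linear₂ l)))

  linear⇒∘-⨁ : {h : Y ⇒ Z} → IsLinear h → (w : Word n) {g : Word n → Word n → X ⇒ Y} →
               h ∘ ⨁ w g ≈ ⨁ w (λ u v → h ∘ g u v)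
  linear⇒∘-⨁ l []       = refl
  linear⇒∘-⨁ l (0F ∷ w) = linear⇒∘-⨁ l w
  linear⇒∘-⨁ l (1F ∷ w) = trans (linear⇒∘-+ l) (+-cong (linear⇒∘-⨁ l w) (linear⇒∘-⨁ l w))

  linear⇒∘-δ : {h : Y ⇒ Z} → IsLinear h → (w : Word n) {g : X ⇒ Y} → h ∘ δ w g ≈ δ w (h ∘ g)
  linear⇒∘-δ l w with does (w ≟ 𝟎)
  ... | true  = refl
  ... | false = linear⇒∘-𝟘 l

  T^ : ∀ n → X ⇒ Y → S^ n X ⇒ S^ n Y
  T^ n = iterate₁ T n

  π₍₎-T₁ : {h : X ⇒ Y} → IsLinear h → ∀ a → π₍ a ₎ ∘ T₁ h ≈ h ∘ π₍ a ₎
  π₍₎-T₁ l 0F = project₀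
  π₍₎-T₁ l 1F = trans project₁ l

  -- Since `T^ (suc n) h` is by definition `T^ n (T₁ h)`, the induction has to range over all linear
  -- `h`; it continues because `T₁ h` is again linear.
  π-T^ : {h : X ⇒ Y} → IsLinear h → (w : Word n) → π w Y ∘ T^ n h ≈ h ∘ π w X
  π-T^ l []      = trans identityˡ (sym identityʳ)
  π-T^ l (a ∷ w) = begin
    _ ≈⟨ pullʳ (π-T^ (linear-T₁ l) w) ⟩
    _ ≈⟨ extendˡ (π₍₎-T₁ l a) ⟩
    _ ∎

  -- Components of the structure maps

  π-ι : (w : Word n) → π w X ∘ ι n X ≈ δ w id
  π-ι {n} w = π-tuple n _ w

  π-θ : (w : Word n) → π w X ∘ θ n X ≈ ⨁ w (λ u v → π u X ∘ π v (S^ n X))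
  π-θ {n} w = trans (π-tuple n _ w) (∑-decompositions w _)

  π-c : ∀ {n m} (u : Word n) (v : Word m) →
        π u X ∘ π v (S^ n X) ∘ c n m X ≈ π v X ∘ π u (S^ m X)
  π-c {n = n} {m} u v = trans (refl⟩∘⟨ π-tuple m _ v) (π-tuple n _ u)

  extend-c : ∀ {n m} (u : Word n) (v : Word m) {f : Z ⇒ S^ n (S^ m X)} →
             π u X ∘ π v (S^ n X) ∘ c n m X ∘ f ≈ π v X ∘ π u (S^ m X) ∘ f
  extend-c u v = trans (refl⟩∘⟨ sym assoc) (extendˡ (π-c u v))

  ππ-jointly-monic : ∀ n m {f g : Z ⇒ S^ m (S^ n X)} →
    (∀ u v → π u X ∘ π v (S^ n X) ∘ f ≈ π u X ∘ π v (S^ n X) ∘ g) → f ≈ g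
  ππ-jointly-monic n m p =
    π-jointly-monic m _ _ λ v → π-jointly-monic n _ _ λ u → p u v

  -- Naturality

  T₁-⟨⟩ : {f : X ⇒ Y} {x u : Z ⇒ X} → T₁ f ∘ ⟨ x , u ⟩ ≈ ⟨ f ∘ x , D f ∘ ⟨ x , u ⟩ ⟩
  T₁-⟨⟩ = trans (sym ⟨⟩∘) (⟨⟩-cong (pullʳ project₀) refl)

  T₁T₁-⟨⟩ : {f : X ⇒ Y} {x u v w : Z ⇒ X} →
    T₁ (T₁ f) ∘ ⟨ ⟨ x , u ⟩ , ⟨ v , w ⟩ ⟩ ≈
    ⟨ ⟨ f ∘ x , D f ∘ ⟨ x , u ⟩ ⟩ , ⟨ D f ∘ ⟨ x , v ⟩ , D (D f) ∘ ⟨ ⟨ x , u ⟩ , ⟨ v , w ⟩ ⟩ ⟩ ⟩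
  T₁T₁-⟨⟩ {f = f} {x} {u} {v} {w} = trans T₁-⟨⟩ (⟨⟩-cong T₁-⟨⟩ (begin
    D (T₁ f) ∘ ⟨ ⟨ x , u ⟩ , ⟨ v , w ⟩ ⟩
      ≈⟨ trans (D-⟨⟩ ⟩∘⟨refl) (sym ⟨⟩∘) ⟩
    ⟨ D (f ∘ π₀) ∘ ⟨ ⟨ x , u ⟩ , ⟨ v , w ⟩ ⟩ , _ ⟩
      -- The chain rule evaluates `D f` at `π₀` of the base point and at `π₀` of the direction,
      -- which are `x` and `v`.
      ≈⟨ ⟨⟩-cong (trans (D-∘ π₀ f ⟩∘⟨refl) (pullʳ (trans (sym ⟨⟩∘) (⟨⟩-cong
           (trans (pullʳ project₀) project₀)
           (trans (linear-π₍₎ 0F ⟩∘⟨refl) (trans (pullʳ project₁) project₀)))))) refl ⟩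
    ⟨ D f ∘ ⟨ x , v ⟩ , D (D f) ∘ ⟨ ⟨ x , u ⟩ , ⟨ v , w ⟩ ⟩ ⟩ ∎))

  SS-eta : (h : Z ⇒ S (S X)) →
    ⟨ ⟨ π₀ ∘ π₀ ∘ h , π₁ ∘ π₀ ∘ h ⟩ , ⟨ π₀ ∘ π₁ ∘ h , π₁ ∘ π₁ ∘ h ⟩ ⟩ ≈ h
  SS-eta h = unique (sym (unique refl refl)) (sym (unique refl refl))

  -- The generic quadruple is the identity of `S (S X)` in the form given by `SS-eta`.
  SS-ext : {f g : S (S X) ⇒ Y} →
    (∀ (x u v w : S (S X) ⇒ X) →
       f ∘ ⟨ ⟨ x , u ⟩ , ⟨ v , w ⟩ ⟩ ≈ g ∘ ⟨ ⟨ x , u ⟩ , ⟨ v , w ⟩ ⟩) → f ≈ g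
  SS-ext p = trans (sym identityʳ) (trans (refl⟩∘⟨ sym (SS-eta id))
    (trans (p _ _ _ _) (trans (refl⟩∘⟨ SS-eta id) identityʳ)))

  π[_] : ∀ a → π (a ∷ []) X ≈ π₍ a ₎
  π[ a ] = identityʳ

  π[_][_] : ∀ a b {h : Z ⇒ S (S X)} →
            (π (a ∷ []) X ∘ π (b ∷ []) (S X)) ∘ h ≈ π₍ a ₎ ∘ π₍ b ₎ ∘ h
  π[ a ][ b ] = trans (∘-cong π[ a ] π[ b ] ⟩∘⟨refl) assoc

  ι₁-natural : (f : X ⇒ Y) → ι 1 Y ∘ f ≈ T₁ f ∘ ι 1 X
  ι₁-natural f = begin
    ⟨ id , 𝟘 ⟩ ∘ f                ≈⟨ ⟨⟩∘ ⟨
    ⟨ id ∘ f , 𝟘 ∘ f ⟩            ≈⟨ ⟨⟩-cong (trans identityˡ (sym identityʳ))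
                                             (trans 𝟘-∘ (sym (D₂.0ᴹ-homo f id))) ⟩
    ⟨ f ∘ id , D f ∘ ⟨ id , 𝟘 ⟩ ⟩ ≈⟨ T₁-⟨⟩ ⟨
    T₁ f ∘ ⟨ id , 𝟘 ⟩             ∎

  -- The entry `w` drops out because it belongs to the pair of letters `1F`, `1F`, which decomposes
  -- no letter.
  θ₁-⟨⟩ : {x u v w : Z ⇒ X} → θ 1 X ∘ ⟨ ⟨ x , u ⟩ , ⟨ v , w ⟩ ⟩ ≈ ⟨ x , u + v ⟩
  θ₁-⟨⟩ {X = X} {x} {u} {v} {w} = begin
    θ 1 X ∘ q
      ≈⟨ ⟨⟩-cong (∑-decompositions (0F ∷ []) ππ) (∑-decompositions (1F ∷ []) ππ) ⟩∘⟨refl ⟩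
    _ ≈⟨ ⟨⟩∘ ⟨
    ⟨ (π (0F ∷ []) X ∘ π (0F ∷ []) (S X)) ∘ q
    , (π (0F ∷ []) X ∘ π (1F ∷ []) (S X) + π (1F ∷ []) X ∘ π (0F ∷ []) (S X)) ∘ q ⟩
      ≈⟨ ⟨⟩-cong π[ 0F ][ 0F ] (trans +-∘ (+-cong π[ 0F ][ 1F ] π[ 1F ][ 0F ])) ⟩
    ⟨ π₀ ∘ π₀ ∘ q , π₀ ∘ π₁ ∘ q + π₁ ∘ π₀ ∘ q ⟩
      ≈⟨ ⟨⟩-cong (trans (refl⟩∘⟨ project₀) project₀)
           -- The decomposition of `1F` with `0F` first is listed first, so the sum arises as
           -- `v + u`.
           (trans (+-comm _ _) (+-cong (trans (refl⟩∘⟨ project₀) project₁)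
                                       (trans (refl⟩∘⟨ project₁) project₀))) ⟩
    ⟨ x , u + v ⟩ ∎
    where
    q = ⟨ ⟨ x , u ⟩ , ⟨ v , w ⟩ ⟩
    ππ = λ (u v : Word 1) → π u X ∘ π v (S X)

  -- This is the exchange of middle entries that appears in `D-symmetric`.
  c₁₁-⟨⟩ : {x u v w : Z ⇒ X} →
           c 1 1 X ∘ ⟨ ⟨ x , u ⟩ , ⟨ v , w ⟩ ⟩ ≈ ⟨ ⟨ x , v ⟩ , ⟨ u , w ⟩ ⟩
  c₁₁-⟨⟩ {X = X} {x} {u} {v} {w} = begin
    c 1 1 X ∘ q
      ≈⟨ trans (sym ⟨⟩∘) (⟨⟩-cong (sym ⟨⟩∘) (sym ⟨⟩∘)) ⟩
    _ ≈⟨ ⟨⟩-cong (⟨⟩-cong π[ 0F ][ 0F ] π[ 0F ][ 1F ]) (⟨⟩-cong π[ 1F ][ 0F ] π[ 1F ][ 1F ]) ⟩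
    _ ≈⟨ ⟨⟩-cong (⟨⟩-cong (trans (refl⟩∘⟨ project₀) project₀) (trans (refl⟩∘⟨ project₁) project₀))
                 (⟨⟩-cong (trans (refl⟩∘⟨ project₀) project₁) (trans (refl⟩∘⟨ project₁) project₁)) ⟩
    ⟨ ⟨ x , v ⟩ , ⟨ u , w ⟩ ⟩ ∎
    where
    q = ⟨ ⟨ x , u ⟩ , ⟨ v , w ⟩ ⟩

  θ₁-natural : (f : X ⇒ Y) → θ 1 Y ∘ T₁ (T₁ f) ≈ T₁ f ∘ θ 1 X
  θ₁-natural {X} {Y} f = SS-ext λ x u v w → begin
    (θ 1 Y ∘ T₁ (T₁ f)) ∘ ⟨ ⟨ x , u ⟩ , ⟨ v , w ⟩ ⟩
      ≈⟨ pullʳ T₁T₁-⟨⟩ ⟩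
    -- The term in `D (D f)` stands in the fourth entry and is discarded; what is left is additivity
    -- of `D f` in the direction.
    _ ≈⟨ θ₁-⟨⟩ ⟩
    ⟨ f ∘ x , D f ∘ ⟨ x , u ⟩ + D f ∘ ⟨ x , v ⟩ ⟩
      ≈⟨ ⟨⟩-cong refl (D₂.+ᴹ-homo f x u v) ⟨
    ⟨ f ∘ x , D f ∘ ⟨ x , u + v ⟩ ⟩
      ≈⟨ T₁-⟨⟩ ⟨
    T₁ f ∘ ⟨ x , u + v ⟩
      ≈⟨ pullʳ θ₁-⟨⟩ ⟨
    (T₁ f ∘ θ 1 X) ∘ ⟨ ⟨ x , u ⟩ , ⟨ v , w ⟩ ⟩ ∎

  c₁₁-natural : (f : X ⇒ Y) → c 1 1 Y ∘ T₁ (T₁ f) ≈ T₁ (T₁ f) ∘ c 1 1 X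
  c₁₁-natural {X} {Y} f = SS-ext λ x u v w → begin
    (c 1 1 Y ∘ T₁ (T₁ f)) ∘ ⟨ ⟨ x , u ⟩ , ⟨ v , w ⟩ ⟩
      ≈⟨ pullʳ T₁T₁-⟨⟩ ⟩
    _ ≈⟨ c₁₁-⟨⟩ ⟩
    ⟨ ⟨ f ∘ x , D f ∘ ⟨ x , v ⟩ ⟩ , ⟨ D f ∘ ⟨ x , u ⟩ , D (D f) ∘ ⟨ ⟨ x , u ⟩ , ⟨ v , w ⟩ ⟩ ⟩ ⟩
      -- Transposition alone matches the first three entries; only the second derivative needs
      -- symmetry.
      ≈⟨ ⟨⟩-cong refl (⟨⟩-cong refl (D-symmetric f x u v w)) ⟩
    ⟨ ⟨ f ∘ x , D f ∘ ⟨ x , v ⟩ ⟩ , ⟨ D f ∘ ⟨ x , u ⟩ , D (D f) ∘ ⟨ ⟨ x , v ⟩ , ⟨ u , w ⟩ ⟩ ⟩ ⟩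
      ≈⟨ T₁T₁-⟨⟩ ⟨
    T₁ (T₁ f) ∘ ⟨ ⟨ x , v ⟩ , ⟨ u , w ⟩ ⟩
      ≈⟨ pullʳ c₁₁-⟨⟩ ⟨
    (T₁ (T₁ f) ∘ c 1 1 X) ∘ ⟨ ⟨ x , u ⟩ , ⟨ v , w ⟩ ⟩ ∎

  -- Recursion of the structure maps in the exponents, and naturality for all exponents.

  T^-square : ∀ n {f : X ⇒ Y} {g : Z ⇒ W} {a : X ⇒ Z} {b : Y ⇒ W} →
              b ∘ f ≈ g ∘ a → T^ n b ∘ T^ n f ≈ T^ n g ∘ T^ n a
  T^-square n p = trans (sym (iterate-∘ T n)) (trans (iterate-cong T n p) (iterate-∘ T n))

  -- At the word `a ∷ w` the factor `ι n` forces `w = 𝟎` and the factor `ι 1` forces `a = 0F`, which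
  -- together single out the zero word.
  ι-suc : ∀ n → ι (suc n) X ≈ ι n (S X) ∘ ι 1 X
  ι-suc {X} n = π-jointly-monic (suc n) _ _ λ { (a ∷ w) → sym (begin
    (π₍ a ₎ ∘ π w (S X)) ∘ ι n (S X) ∘ ι 1 X
      ≈⟨ pullʳ (pullˡ (π-ι w)) ⟩
    π₍ a ₎ ∘ δ w id ∘ ι 1 X
      ≈⟨ refl⟩∘⟨ trans (δ-∘ w) (δ-cong w identityˡ) ⟩
    π₍ a ₎ ∘ δ w (ι 1 X)
      ≈⟨ linear⇒∘-δ (linear-π₍₎ a) w ⟩
    δ w (π₍ a ₎ ∘ ι 1 X)
      ≈⟨ π₍₎-ι₁ a w ⟩
    δ (a ∷ w) id
      ≈⟨ π-ι (a ∷ w) ⟨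
    π (a ∷ w) X ∘ ι (suc n) X ∎) }
    where
    π₍₎-ι₁ : ∀ a (w : Word n) → δ w (π₍ a ₎ ∘ ι 1 X) ≈ δ (a ∷ w) id
    π₍₎-ι₁ 0F w = δ-cong w project₀
    π₍₎-ι₁ 1F w = trans (δ-cong w project₁) (δ-𝟘 w)

  ι-natural : ∀ n (f : X ⇒ Y) → ι n Y ∘ f ≈ T^ n f ∘ ι n X
  ι-natural zero    f = trans identityˡ (sym identityʳ)
  ι-natural (suc n) f =
    trans (ι-suc n ⟩∘⟨refl)
      (trans (glue (ι-natural n (T₁ f)) (ι₁-natural f)) (refl⟩∘⟨ sym (ι-suc n)))

  c-zeroˡ : ∀ m → c 0 m X ≈ id
  c-zeroˡ m = ππ-jointly-monic 0 m λ { [] v →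
    trans (π-c [] v) (trans identityʳ (trans (sym identityʳ) (sym (pullˡ identityˡ)))) }

  c-zeroʳ : ∀ n → c n 0 X ≈ id
  c-zeroʳ n = ππ-jointly-monic n 0 λ { u [] →
    trans (π-c u []) (trans identityˡ (trans (sym identityʳ) (refl⟩∘⟨ sym identityˡ))) }

  -- The innermost of the `suc n` copies crosses the block of `m` copies first, under `T^ n`; the
  -- other `n` follow.
  c-sucˡ : ∀ n m → c (suc n) m X ≈ c n m (S X) ∘ T^ n (c 1 m X)
  c-sucˡ {X} n m = ππ-jointly-monic (suc n) m λ { (a ∷ u) v → sym (begin
    (π₍ a ₎ ∘ π u (S X)) ∘ π v _ ∘ c n m (S X) ∘ T^ n (c 1 m X)
      ≈⟨ pullʳ (extend-c u v) ⟩
    π₍ a ₎ ∘ π v (S X) ∘ π u (S^ m (S X)) ∘ T^ n (c 1 m X)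
      ≈⟨ refl⟩∘⟨ refl⟩∘⟨ π-T^ (linear-c 1 m) u ⟩
    π₍ a ₎ ∘ π v (S X) ∘ c 1 m X ∘ π u (S (S^ m X))
      ≈⟨ π[ a ] ⟩∘⟨refl ⟨
    π (a ∷ []) X ∘ π v (S X) ∘ c 1 m X ∘ π u (S (S^ m X))
      ≈⟨ extend-c (a ∷ []) v ⟩
    π v X ∘ π (a ∷ []) (S^ m X) ∘ π u (S (S^ m X))
      ≈⟨ refl⟩∘⟨ π[ a ] ⟩∘⟨refl ⟩
    π v X ∘ π₍ a ₎ ∘ π u (S (S^ m X))
      ≈⟨ π-c (a ∷ u) v ⟨
    π (a ∷ u) X ∘ π v _ ∘ c (suc n) m X ∎) }

  -- The block of `n` copies first crosses the outer `m` copies and then, under `T^ m`, the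
  -- innermost one.
  c-sucʳ : ∀ n m → c n (suc m) X ≈ T^ m (c n 1 X) ∘ c n m (S X)
  c-sucʳ {X} n m = ππ-jointly-monic n (suc m) λ { u (b ∷ v) → sym (begin
    π u X ∘ (π₍ b ₎ ∘ π v _) ∘ T^ m (c n 1 X) ∘ c n m (S X)
      ≈⟨ refl⟩∘⟨ pullʳ (extendˡ (π-T^ (linear-c n 1) v)) ⟩
    π u X ∘ π₍ b ₎ ∘ c n 1 X ∘ π v _ ∘ c n m (S X)
      ≈⟨ refl⟩∘⟨ π[ b ] ⟩∘⟨refl ⟨
    π u X ∘ π (b ∷ []) (S^ n X) ∘ c n 1 X ∘ π v _ ∘ c n m (S X)
      ≈⟨ extend-c u (b ∷ []) ⟩
    π (b ∷ []) X ∘ π u (S X) ∘ π v _ ∘ c n m (S X)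
      ≈⟨ π[ b ] ⟩∘⟨refl ⟩
    π₍ b ₎ ∘ π u (S X) ∘ π v _ ∘ c n m (S X)
      ≈⟨ refl⟩∘⟨ π-c u v ⟩
    π₍ b ₎ ∘ π v (S X) ∘ π u _
      ≈⟨ assoc ⟨
    π (b ∷ v) X ∘ π u _
      ≈⟨ π-c u (b ∷ v) ⟨
    π u X ∘ π (b ∷ v) _ ∘ c n (suc m) X ∎) }

  -- The case of a single outer copy is separate because the induction in `c-natural` applies `T^ n`
  -- to this square.
  c₁-natural : ∀ m (f : X ⇒ Y) → c 1 m Y ∘ T₁ (T^ m f) ≈ T^ m (T₁ f) ∘ c 1 m X
  c₁-natural zero f = ≈id-commute (c-zeroʳ 1) (c-zeroʳ 1)
  c₁-natural (suc m) f =
    trans (c-sucʳ 1 m ⟩∘⟨refl)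
      (trans (glue (T^-square m (c₁₁-natural f)) (c₁-natural m (T₁ f)))
             (refl⟩∘⟨ sym (c-sucʳ 1 m)))

  c-natural : ∀ n m (f : X ⇒ Y) → c n m Y ∘ T^ n (T^ m f) ≈ T^ m (T^ n f) ∘ c n m X
  c-natural zero m f = ≈id-commute (c-zeroˡ m) (c-zeroˡ m)
  c-natural (suc n) m f =
    trans (c-sucˡ n m ⟩∘⟨refl)
      (trans (glue (c-natural n m (T₁ f)) (T^-square n (c₁-natural m f)))
             (refl⟩∘⟨ sym (c-sucˡ n m)))

  -- Words are decomposed letter by letter, so the first letter can be treated apart from the tail.
  -- The exchange makes the two blocks of `n` copies adjacent; `θ n` then merges the blocks and
  -- `θ 1` the two innermost copies.
  θ-suc : ∀ n → θ (suc n) X ≈ T^ n (θ 1 X) ∘ θ n (S (S X)) ∘ T^ n (c 1 n (S X))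
  θ-suc {X} n = π-jointly-monic (suc n) _ _ λ { (a ∷ w) → sym (begin
    (π₍ a ₎ ∘ π w (S X)) ∘ T^ n (θ 1 X) ∘ K
      ≈⟨ pullʳ (extendˡ (π-T^ (linear-θ 1) w)) ⟩
    π₍ a ₎ ∘ θ 1 X ∘ π w (S (S X)) ∘ K
      ≈⟨ pullˡ (sym π[ a ] ⟩∘⟨refl) ⟩
    (π (a ∷ []) X ∘ θ 1 X) ∘ π w (S (S X)) ∘ K
      ≈⟨ π-θ (a ∷ []) ⟩∘⟨refl ⟩
    ⨁ (a ∷ []) (λ u v → π u X ∘ π v (S X)) ∘ π w (S (S X)) ∘ K
      ≈⟨ split a w ⟩
    ⨁ (a ∷ w) (λ u v → π u X ∘ π v _)
      ≈⟨ π-θ (a ∷ w) ⟨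
    π (a ∷ w) X ∘ θ (suc n) X ∎) }
    where
    K = θ n (S (S X)) ∘ T^ n (c 1 n (S X))

    -- The contribution of one fixed pair of leading letters; `split` adds these over the
    -- decompositions of the leading letter of the word.
    term : ∀ a b (w : Word n) →
      (π (a ∷ []) X ∘ π (b ∷ []) (S X)) ∘ π w (S (S X)) ∘ K ≈
      ⨁ w (λ u v → π (a ∷ u) X ∘ π (b ∷ v) (S^ n (S X)))
    term a b w = begin
      (π (a ∷ []) X ∘ π (b ∷ []) (S X)) ∘ π w (S (S X)) ∘ K
        ≈⟨ ∘-cong (∘-cong π[ a ] π[ b ]) (trans (pullˡ (π-θ w)) (⨁-∘ w)) ⟩
      (π₍ a ₎ ∘ π₍ b ₎) ∘ ⨁ w (λ u v → (π u _ ∘ π v _) ∘ T^ n (c 1 n (S X)))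
        ≈⟨ linear⇒∘-⨁ (linear-∘ (linear-π₍₎ a) (linear-π₍₎ b)) w ⟩
      ⨁ w (λ u v → (π₍ a ₎ ∘ π₍ b ₎) ∘ (π u _ ∘ π v _) ∘ T^ n (c 1 n (S X)))
        ≈⟨ (⨁-cong w λ u v → begin
             (π₍ a ₎ ∘ π₍ b ₎) ∘ (π u _ ∘ π v _) ∘ T^ n (c 1 n (S X))
               ≈⟨ trans assoc (refl⟩∘⟨ refl⟩∘⟨ pullʳ (π-T^ (linear-c 1 n) v)) ⟩
             π₍ a ₎ ∘ π₍ b ₎ ∘ π u (S (S X)) ∘ c 1 n (S X) ∘ π v _
               ≈⟨ refl⟩∘⟨ π[ b ] ⟩∘⟨refl ⟨
             π₍ a ₎ ∘ π (b ∷ []) (S X) ∘ π u (S (S X)) ∘ c 1 n (S X) ∘ π v _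
               -- The exchange carries the letter `b` past `u` to its tail `v`, so that `π (b ∷ v)`
               -- can be formed.
               ≈⟨ refl⟩∘⟨ extend-c (b ∷ []) u ⟩
             π₍ a ₎ ∘ π u (S X) ∘ π (b ∷ []) (S^ n (S X)) ∘ π v _
               ≈⟨ refl⟩∘⟨ refl⟩∘⟨ π[ b ] ⟩∘⟨refl ⟩
             π₍ a ₎ ∘ π u (S X) ∘ π₍ b ₎ ∘ π v _
               ≈⟨ assoc ⟨
             (π₍ a ₎ ∘ π u (S X)) ∘ π₍ b ₎ ∘ π v _ ∎) ⟩
      ⨁ w (λ u v → π (a ∷ u) X ∘ π (b ∷ v) _) ∎

    split : ∀ a (w : Word n) →
      ⨁ (a ∷ []) (λ u v → π u X ∘ π v (S X)) ∘ π w (S (S X)) ∘ K ≈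
      ⨁ (a ∷ w) (λ u v → π u X ∘ π v (S^ n (S X)))
    split 0F w = term 0F 0F w
    split 1F w = trans +-∘ (+-cong (term 0F 1F w) (term 1F 0F w))

  θ-natural : ∀ n (f : X ⇒ Y) → θ n Y ∘ T^ n (T^ n f) ≈ T^ n f ∘ θ n X
  θ-natural zero f = ≈id-commute θ₀ θ₀
    where
    θ₀ : θ 0 Z ≈ id
    θ₀ = trans (sym identityˡ) (trans (π-θ []) identityˡ)
  θ-natural (suc n) f =
    trans (θ-suc n ⟩∘⟨refl)
      (trans (glue (T^-square n (θ₁-natural f))
                   -- The hypothesis is used at `T₁ (T₁ f)`: after the exchange both innermost
                   -- copies lie inside the two blocks that `θ n` merges.
                   (glue (θ-natural n (T₁ (T₁ f))) (T^-square n (c₁-natural n (T₁ f)))))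
             (refl⟩∘⟨ sym (θ-suc n)))

  -- Monad and distributive laws

  θ-isMonad : ∀ n → IsMonad (T ^F n) (ι n) (θ n)
  θ-isMonad n = record
    { η-natural   = ι-natural n
    ; μ-natural   = θ-natural n
    -- Both sides expand to a double convolution of threefold projections. On the left this uses
    -- linearity of `θ`, on the right linearity of `π x`.
    ; μ-assoc     = λ X → π-jointly-monic n _ _ λ w → begin
        π w X ∘ θ n X ∘ T^ n (θ n X)
          ≈⟨ trans (pullˡ (π-θ w)) (⨁-∘ w) ⟩
        ⨁ w (λ s z → (π s X ∘ π z _) ∘ T^ n (θ n X))
          ≈⟨ (⨁-cong w λ s z → begin
               (π s X ∘ π z _) ∘ T^ n (θ n X)
                 ≈⟨ pullʳ (π-T^ (linear-θ n) z) ⟩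
               π s X ∘ θ n X ∘ π z _
                 ≈⟨ trans (pullˡ (π-θ s)) (⨁-∘ s) ⟩
               ⨁ s (λ x y → (π x X ∘ π y _) ∘ π z _) ∎) ⟩
        ⨁ w (λ s z → ⨁ s (λ x y → (π x X ∘ π y _) ∘ π z _))
          ≈⟨ ⨁-assoc w ⟩
        ⨁ w (λ x s → ⨁ s (λ y z → (π x X ∘ π y _) ∘ π z _))
          ≈⟨ (⨁-cong w λ x s → begin
               ⨁ s (λ y z → (π x X ∘ π y _) ∘ π z _)
                 ≈⟨ ⨁-cong s (λ y z → assoc) ⟩
               ⨁ s (λ y z → π x X ∘ π y _ ∘ π z _)
                 ≈⟨ linear⇒∘-⨁ (linear-π x) s ⟨
               π x X ∘ ⨁ s (λ y z → π y _ ∘ π z _)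
                 ≈⟨ pullʳ (π-θ s) ⟨
               (π x X ∘ π s _) ∘ θ n (S^ n X) ∎) ⟩
        ⨁ w (λ x s → (π x X ∘ π s _) ∘ θ n (S^ n X))
          ≈⟨ trans (pullˡ (π-θ w)) (⨁-∘ w) ⟨
        π w X ∘ θ n X ∘ θ n (S^ n X) ∎
    ; μ-identityˡ = λ X → π-jointly-monic n _ _ λ w → begin
        π w X ∘ θ n X ∘ T^ n (ι n X)
          ≈⟨ trans (pullˡ (π-θ w)) (⨁-∘ w) ⟩
        ⨁ w (λ u v → (π u X ∘ π v _) ∘ T^ n (ι n X))
          ≈⟨ (⨁-cong w λ u v → begin
               (π u X ∘ π v _) ∘ T^ n (ι n X) ≈⟨ pullʳ (π-T^ (linear-ι n) v) ⟩
               π u X ∘ ι n X ∘ π v X          ≈⟨ trans (pullˡ (π-ι u)) (δ-∘ u) ⟩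
               δ u (id ∘ π v X)               ≈⟨ δ-cong u identityˡ ⟩
               δ u (π v X)                    ∎) ⟩
        ⨁ w (λ u v → δ u (π v X))
          ≈⟨ ⨁-identityˡ w ⟩
        π w X
          ≈⟨ identityʳ ⟨
        π w X ∘ id ∎
    -- Here `ι` meets the outer projection, so the unit `δ` falls on the second word, whereas in the
    -- previous law it falls on the first.
    ; μ-identityʳ = λ X → π-jointly-monic n _ _ λ w → begin
        π w X ∘ θ n X ∘ ι n (S^ n X)
          ≈⟨ trans (pullˡ (π-θ w)) (⨁-∘ w) ⟩
        ⨁ w (λ u v → (π u X ∘ π v _) ∘ ι n (S^ n X))
          ≈⟨ (⨁-cong w λ u v → begin
               (π u X ∘ π v _) ∘ ι n (S^ n X) ≈⟨ pullʳ (π-ι v) ⟩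
               π u X ∘ δ v id                 ≈⟨ linear⇒∘-δ (linear-π u) v ⟩
               δ v (π u X ∘ id)               ≈⟨ δ-cong v identityʳ ⟩
               δ v (π u X)                    ∎) ⟩
        ⨁ w (λ u v → δ v (π u X))
          ≈⟨ ⨁-identityʳ w ⟩
        π w X
          ≈⟨ identityʳ ⟨
        π w X ∘ id ∎
    }

  -- On components `c` only interchanges the projections for `u` and `v`. Each unit or
  -- multiplication then affects one of the two words, and linearity of the projection for the other
  -- word moves it past `δ` or `⨁`.
  c-isDistributiveLaw : ∀ n m → IsDistributiveLaw (θ-isMonad n) (θ-isMonad m) (c n m)
  c-isDistributiveLaw n m = record
    { natural = c-natural n m
    ; unitᴹ   = λ X → ππ-jointly-monic n m λ u v → begin
        π u X ∘ π v _ ∘ c n m X ∘ ι n (S^ m X)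
          ≈⟨ extend-c u v ⟩
        π v X ∘ π u _ ∘ ι n (S^ m X)
          ≈⟨ refl⟩∘⟨ π-ι u ⟩
        π v X ∘ δ u id
          ≈⟨ linear⇒∘-δ (linear-π v) u ⟩
        δ u (π v X ∘ id)
          ≈⟨ δ-cong u (trans identityʳ (sym identityˡ)) ⟩
        δ u (id ∘ π v X)
          ≈⟨ trans (pullˡ (π-ι u)) (δ-∘ u) ⟨
        π u X ∘ ι n X ∘ π v X
          ≈⟨ refl⟩∘⟨ π-T^ (linear-ι n) v ⟨
        π u X ∘ π v _ ∘ T^ m (ι n X) ∎
    ; unitᴺ   = λ X → ππ-jointly-monic n m λ u v → begin
        π u X ∘ π v _ ∘ c n m X ∘ T^ n (ι m X)
          ≈⟨ extend-c u v ⟩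
        π v X ∘ π u _ ∘ T^ n (ι m X)
          ≈⟨ refl⟩∘⟨ π-T^ (linear-ι m) u ⟩
        π v X ∘ ι m X ∘ π u X
          ≈⟨ trans (pullˡ (π-ι v)) (δ-∘ v) ⟩
        δ v (id ∘ π u X)
          ≈⟨ δ-cong v (trans identityˡ (sym identityʳ)) ⟩
        δ v (π u X ∘ id)
          ≈⟨ linear⇒∘-δ (linear-π u) v ⟨
        π u X ∘ δ v id
          ≈⟨ refl⟩∘⟨ π-ι v ⟨
        π u X ∘ π v _ ∘ ι m (S^ n X) ∎
    ; multᴹ   = λ X → ππ-jointly-monic n m λ u v → begin
        π u X ∘ π v _ ∘ c n m X ∘ θ n (S^ m X)
          ≈⟨ extend-c u v ⟩
        π v X ∘ π u _ ∘ θ n (S^ m X)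
          ≈⟨ refl⟩∘⟨ π-θ u ⟩
        π v X ∘ ⨁ u (λ x y → π x _ ∘ π y _)
          ≈⟨ linear⇒∘-⨁ (linear-π v) u ⟩
        ⨁ u (λ x y → π v X ∘ π x _ ∘ π y _)
          -- The parts `y` and `x` of `u` cross `v` one after the other, each using up one of the
          -- two exchanges.
          ≈⟨ (⨁-cong u λ x y → sym (begin
               (π x X ∘ π y _) ∘ π v _ ∘ c n m (S^ n X) ∘ T^ n (c n m X)
                 ≈⟨ pullʳ (extend-c y v) ⟩
               π x X ∘ π v _ ∘ π y _ ∘ T^ n (c n m X)
                 ≈⟨ refl⟩∘⟨ refl⟩∘⟨ π-T^ (linear-c n m) y ⟩
               π x X ∘ π v _ ∘ c n m X ∘ π y _
                 ≈⟨ extend-c x v ⟩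
               π v X ∘ π x _ ∘ π y _ ∎)) ⟩
        ⨁ u (λ x y → (π x X ∘ π y _) ∘ π v _ ∘ c n m (S^ n X) ∘ T^ n (c n m X))
          ≈⟨ trans (pullˡ (π-θ u)) (⨁-∘ u) ⟨
        π u X ∘ θ n X ∘ π v _ ∘ c n m (S^ n X) ∘ T^ n (c n m X)
          ≈⟨ refl⟩∘⟨ extendˡ (π-T^ (linear-θ n) v) ⟨
        π u X ∘ π v _ ∘ T^ m (θ n X) ∘ c n m (S^ n X) ∘ T^ n (c n m X) ∎
    ; multᴺ   = λ X → ππ-jointly-monic n m λ u v → begin
        π u X ∘ π v _ ∘ c n m X ∘ T^ n (θ m X)
          ≈⟨ extend-c u v ⟩
        π v X ∘ π u _ ∘ T^ n (θ m X)
          ≈⟨ refl⟩∘⟨ π-T^ (linear-θ m) u ⟩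
        π v X ∘ θ m X ∘ π u _
          ≈⟨ trans (pullˡ (π-θ v)) (⨁-∘ v) ⟩
        ⨁ v (λ x y → (π x X ∘ π y _) ∘ π u _)
          ≈⟨ (⨁-cong v λ x y → sym (begin
               π u X ∘ (π x _ ∘ π y _) ∘ T^ m (c n m X) ∘ c n m (S^ m X)
                 ≈⟨ refl⟩∘⟨ pullʳ (extendˡ (π-T^ (linear-c n m) y)) ⟩
               π u X ∘ π x _ ∘ c n m X ∘ π y _ ∘ c n m (S^ m X)
                 ≈⟨ extend-c u x ⟩
               π x X ∘ π u _ ∘ π y _ ∘ c n m (S^ m X)
                 ≈⟨ refl⟩∘⟨ π-c u y ⟩
               π x X ∘ π y _ ∘ π u _
                 ≈⟨ assoc ⟨
               (π x X ∘ π y _) ∘ π u _ ∎)) ⟩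
        ⨁ v (λ x y → π u X ∘ (π x _ ∘ π y _) ∘ T^ m (c n m X) ∘ c n m (S^ m X))
          ≈⟨ linear⇒∘-⨁ (linear-π u) v ⟨
        π u X ∘ ⨁ v (λ x y → (π x _ ∘ π y _) ∘ T^ m (c n m X) ∘ c n m (S^ m X))
          ≈⟨ refl⟩∘⟨ trans (pullˡ (π-θ v)) (⨁-∘ v) ⟨
        π u X ∘ π v _ ∘ θ m (S^ n X) ∘ T^ m (c n m X) ∘ c n m (S^ m X) ∎
    }

theorem2 : ∀ {r ℓr o ℓ e : Level} (R : CommutativeSemiring r ℓr)
    (C : CartesianDifferentialCategory R o ℓ e) →
    let open Tangent C in
    (∀ n → IsNatural Id (T ^F n) (ι n)) ×
    (∀ n → IsNatural (T ^F n ∘F T ^F n) (T ^F n) (θ n)) ×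
    (∀ n m → IsNatural (T ^F n ∘F T ^F m) (T ^F m ∘F T ^F n) (c n m)) ×
    (Σ[ T-isMonad ∈ (∀ n → IsMonad (T ^F n) (ι n) (θ n)) ]
    (∀ n m → IsDistributiveLaw (T-isMonad n) (T-isMonad m) (c n m)))
theorem2 R C =
  (λ n → ι-natural n) , (λ n → θ-natural n) , (λ n m → c-natural n m) ,
  θ-isMonad , c-isDistributiveLaw
  where open Properties C
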